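{- Let $\langle\mathfrak{B},\Diamond\rangle$ be a complete KTB-algebra (i.e. a KTB-algebra whose underlying Boolean algebra is complete). Then $$\mathsf{C}_{\diamond}=\{\langle x,y\rangle\in B\times B\mid x\cdot\Diamond y\neq\mathbf{0}\}$$ is a contact relation on $\mathfrak{B}$ that satisfies (C4$^c$). Moreover $\Diamond=m$, where $m\colon B\to B$ is the operator assigning to each $x\in B$ the unique $y\in B$ such that $\{z\in B\mid z\mathrel{\mathsf{C}_{\diamond}}x\}=\{z\in B\mid z\cdot y\neq\mathbf{0}\}$.
   Context: A possibility operator on a Boolean algebra $\mathfrak{B}=\langle B,\cdot,+,-,\mathbf{0},\mathbf{1}\rangle$ is a map $\Diamond\colon B\to B$ with $\Diamond\mathbf{0}=\mathbf{0}$ and $\Diamond(x+y)=\Diamond x+\Diamond y$. A KTB-algebra is a modal algebra $\langle\mathfrak{B},\Diamond\rangle$, with $\Diamond$ a possibility operator, such that $x\leq\Diamond x$ and $\Diamond\Box x\leq x$ for all $x\in B$, where $\Box x=-\Diamond(-x)$. A contact relation on $\mathfrak{B}$ is a relation $\mathsf{C}\subseteq B\times B$ satisfying, for all $x,y,z\in B$: (C0) not $\mathbf{0}\mathrel{\mathsf{C}}x$; (C1) if $x\le y$ and $x\ne\mathbf{0}$, then $x\mathrel{\mathsf{C}}y$; (C2) if $x\mathrel{\mathsf{C}}y$, then $y\mathrel{\mathsf{C}}x$; (C3) if $x\le y$ and $z\mathrel{\mathsf{C}}x$, then $z\mathrel{\mathsf{C}}y$; (C4) if $x\mathrel{\mathsf{C}}(y+z)$,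 then $x\mathrel{\mathsf{C}}y$ or $x\mathrel{\mathsf{C}}z$. (C4$^c$): for every $x\in B$ and every $J\subseteq B$, if $x\mathrel{\mathsf{C}}\bigvee J$, then there is $y\in J$ with $x\mathrel{\mathsf{C}}y$. -}

module Defs where

open import Level using (Level; _⊔_; suc)
open import Algebra.Core using (Op₁)
open import Algebra.Lattice.Bundles using (BooleanAlgebra)
import Algebra.Lattice.Properties.BooleanAlgebra as BooleanAlgebraProperties
open import Data.Product.Base using (∃; _×_)
open import Data.Sum.Base using (_⊎_)
open import Relation.Binary.Bundles using (Poset)
open import Relation.Binary.Core using (Rel)
open import Relation.Nullary.Negation using () renaming (¬_ to Not_)
open import Relation.Unary using (Pred; _∈_; _≐_)

module _ {c ℓ : Level} (B : BooleanAlgebra c ℓ) where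

  open BooleanAlgebra B
  open Poset (BooleanAlgebraProperties.poset B) using (_≤_)

  record IsPossibilityOperator (◇ : Op₁ Carrier) : Set (c ⊔ ℓ) where
    field
      -- Carrier is a setoid, so being a map on B includes respecting _≈_.
      ◇-cong : ∀ {x y} → x ≈ y → ◇ x ≈ ◇ y
      ◇-⊥    : ◇ ⊥ ≈ ⊥
      ◇-∨    : ∀ x y → ◇ (x ∨ y) ≈ ◇ x ∨ ◇ y

  □Of : Op₁ Carrier → Op₁ Carrier
  □Of ◇ x = ¬ ◇ (¬ x)

  record IsKTB (◇ : Op₁ Carrier) : Set (c ⊔ ℓ) where
    field
      isPossibilityOperator : IsPossibilityOperator ◇
      x≤◇x                  : ∀ x → x ≤ ◇ x
      ◇□x≤x                 : ∀ x → ◇ (□Of ◇ x) ≤ x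

  -- Subsets are arbitrary predicates. A predicate that does not respect _≈_
  -- has the same upper bounds as its closure under _≈_.
  record IsSupremum {p : Level} (J : Pred Carrier p) (s : Carrier) : Set (c ⊔ ℓ ⊔ p) where
    field
      upper : ∀ {y} → y ∈ J → y ≤ s
      least : ∀ {u} → (∀ {y} → y ∈ J → y ≤ u) → s ≤ u

  -- In a Boolean algebra the existence of all suprema gives all infima.
  IsComplete : (p : Level) → Set (c ⊔ ℓ ⊔ suc p)
  IsComplete p = (J : Pred Carrier p) → ∃ (IsSupremum J)

  record IsContact {r : Level} (_C_ : Rel Carrier r) : Set (c ⊔ ℓ ⊔ r) where
    field
      C0 : ∀ {x} → Not (⊥ C x)
      C1 : ∀ {x y} → x ≤ y → x ≉ ⊥ → x C y
      C2 : ∀ {x y} → x C y → y C x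
      C3 : ∀ {x y z} → x ≤ y → z C x → z C y
      C4 : ∀ {x y z} → x C (y ∨ z) → x C y ⊎ x C z

  C4ᶜ : {r : Level} (p : Level) → Rel Carrier r → Set (c ⊔ ℓ ⊔ suc p ⊔ r)
  C4ᶜ p _C_ = ∀ x (J : Pred Carrier p) {⋁J} → IsSupremum J ⋁J →
              x C ⋁J → ∃ λ y → y ∈ J × x C y

  ContactOf : Op₁ Carrier → Rel Carrier ℓ
  ContactOf ◇ x y = x ∧ ◇ y ≉ ⊥

  Represents : {r : Level} → Rel Carrier r → Rel Carrier (c ⊔ ℓ ⊔ r)
  Represents _C_ x y = (λ z → z C x) ≐ (λ z → z ∧ y ≉ ⊥)

{-# OPTIONS --safe #-}
-- The key fact is that ◇ is self-conjugate: x ∧ ◇ y ≈ ⊥ iff ◇ x ∧ y ≈ ⊥.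
-- Indeed, if x ≤ ¬ ◇ y ≈ □ (¬ y), then ◇ x ≤ ◇ □ (¬ y) ≤ ¬ y.  This is the
-- symmetry (C2), and it gives (C4ᶜ): if x ∧ ◇ y ≈ ⊥ for all y ∈ J, then ¬ ◇ x
-- is an upper bound of J, hence above ⋁ J, and so x ∧ ◇ (⋁ J) ≈ ⊥.
module Submission where

open import Defs
open import Level using (Level; _⊔_; lift; lower)
open import Algebra.Core using (Op₁)
open import Algebra.Lattice.Bundles using (BooleanAlgebra)
import Algebra.Lattice.Properties.BooleanAlgebra as BooleanAlgebraProperties
open import Axiom.DoubleNegationElimination using (DoubleNegationElimination; em⇒dne)
open import Axiom.ExcludedMiddle using (ExcludedMiddle)
open import Data.Product using (_×_; ∃!; _,_; proj₁; proj₂)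
open import Data.Sum.Base using (_⊎_; inj₁; inj₂)
open import Function.Base using (id)
import Relation.Binary.Lattice as OrderTheoretic
import Relation.Binary.Lattice.Properties.JoinSemilattice as JoinSemilatticeProperties
import Relation.Binary.Reasoning.PartialOrder as ≤-Reasoning
import Relation.Binary.Reasoning.Setoid as ≈-Reasoning
open import Relation.Nullary.Decidable using (map′; yes; no)

-- A proposition is decided by deciding its lift, so excluded middle at the joint level also decides
-- equations in `ℓ`.
lowerExcludedMiddle : ∀ {a} b → ExcludedMiddle (a ⊔ b) → ExcludedMiddle a
lowerExcludedMiddle b em = map′ lower (lift {ℓ = b}) em

module Order {c ℓ : Level} (B : BooleanAlgebra c ℓ) where

  open BooleanAlgebra B
  open BooleanAlgebraProperties B
  open OrderTheoretic.Lattice ∨-∧-orderTheoreticLattice public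
    using (_≤_; antisym; x≤x∨y; joinSemilattice)
    renaming (trans to ≤-trans)
  open JoinSemilatticeProperties joinSemilattice public using (x≤y⇒x∨y≈y)
  open ≈-Reasoning setoid

  x≤¬y⇒x∧y≈⊥ : ∀ {x y} → x ≤ ¬ y → x ∧ y ≈ ⊥
  x≤¬y⇒x∧y≈⊥ {x} {y} x≤¬y = begin
    -- The order unfolds to `x ≈ x ∧ ¬ y`, so the hypothesis itself is a rewriting step.
    x ∧ y          ≈⟨ ∧-congʳ x≤¬y ⟩
    (x ∧ ¬ y) ∧ y  ≈⟨ ∧-assoc x (¬ y) y ⟩
    x ∧ (¬ y ∧ y)  ≈⟨ ∧-congˡ (∧-complementˡ y) ⟩
    x ∧ ⊥          ≈⟨ ∧-zeroʳ x ⟩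
    ⊥              ∎

  x∧y≈⊥⇒x≤¬y : ∀ {x y} → x ∧ y ≈ ⊥ → x ≤ ¬ y
  x∧y≈⊥⇒x≤¬y {x} {y} x∧y≈⊥ = begin
    x                    ≈⟨ ∧-identityʳ x ⟨
    x ∧ ⊤                ≈⟨ ∧-congˡ (∨-complementʳ y) ⟨
    x ∧ (y ∨ ¬ y)        ≈⟨ ∧-distribˡ-∨ x y (¬ y) ⟩
    (x ∧ y) ∨ (x ∧ ¬ y)  ≈⟨ ∨-congʳ x∧y≈⊥ ⟩
    ⊥ ∨ (x ∧ ¬ y)        ≈⟨ ∨-identityˡ (x ∧ ¬ y) ⟩
    x ∧ ¬ y              ∎

  ∧-disjoint-≤ : ∀ {x y z} → x ≤ y → z ∧ y ≈ ⊥ → z ∧ x ≈ ⊥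
  ∧-disjoint-≤ {x} {y} {z} x≤y z∧y≈⊥ = trans (∧-comm z x)
    (x≤¬y⇒x∧y≈⊥ (≤-trans x≤y (x∧y≈⊥⇒x≤¬y (trans (∧-comm y z) z∧y≈⊥))))

  ¬y∧x≈⊥⇒x≤y : ∀ {x y} → ¬ y ∧ x ≈ ⊥ → x ≤ y
  ¬y∧x≈⊥⇒x≤y {x} {y} ¬y∧x≈⊥ = begin
    x            ≈⟨ x∧y≈⊥⇒x≤¬y (trans (∧-comm x (¬ y)) ¬y∧x≈⊥) ⟩
    x ∧ ¬ (¬ y)  ≈⟨ ∧-congˡ (¬-involutive y) ⟩
    x ∧ y        ∎

  module _ (dne : DoubleNegationElimination ℓ)
           {r} (_C_ : Carrier → Carrier → Set r) where

    -- The test element is `¬ z`: if it met `y`, it would be in contact with `x` and so would meet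
    -- `z`.
    represents-≤ : ∀ {x y z} → Represents B _C_ x y → Represents B _C_ x z → y ≤ z
    represents-≤ {z = z} x↦y x↦z =
      ¬y∧x≈⊥⇒x≤y (dne λ ¬z∧y≉⊥ →
        proj₁ x↦z (proj₂ x↦y ¬z∧y≉⊥) (∧-complementˡ z))

    represents-unique : ∀ {x y z} → Represents B _C_ x y → Represents B _C_ x z → y ≈ z
    represents-unique x↦y x↦z = antisym (represents-≤ x↦y x↦z) (represents-≤ x↦z x↦y)

module KTB {c ℓ : Level} (B : BooleanAlgebra c ℓ)
           {◇ : Op₁ (BooleanAlgebra.Carrier B)} (isKTB : IsKTB B ◇) where

  open BooleanAlgebra B
  open BooleanAlgebraProperties B
  open Order B
  open IsKTB isKTB
  open IsPossibilityOperator isPossibilityOperator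

  ◇-mono : ∀ {x y} → x ≤ y → ◇ x ≤ ◇ y
  ◇-mono {x} {y} x≤y = begin
    ◇ x        ≤⟨ x≤x∨y (◇ x) (◇ y) ⟩
    ◇ x ∨ ◇ y  ≈⟨ ◇-∨ x y ⟨
    ◇ (x ∨ y)  ≈⟨ ◇-cong (x≤y⇒x∨y≈y x≤y) ⟩
    ◇ y        ∎
    where open ≤-Reasoning poset

  ◇-conjugate : ∀ {x y} → x ∧ ◇ y ≈ ⊥ → ◇ x ∧ y ≈ ⊥
  ◇-conjugate {x} {y} x∧◇y≈⊥ = x≤¬y⇒x∧y≈⊥ (begin
    ◇ x                ≤⟨ ◇-mono (x∧y≈⊥⇒x≤¬y x∧◇y≈⊥) ⟩
    -- `□Of B ◇ (¬ y)` unfolds to `¬ ◇ (¬ (¬ y))`, hence the double complement.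
    ◇ (¬ ◇ y)          ≈⟨ ◇-cong (¬-cong (◇-cong (¬-involutive y))) ⟨
    ◇ (□Of B ◇ (¬ y))  ≤⟨ ◇□x≤x (¬ y) ⟩
    ¬ y                ∎)
    where open ≤-Reasoning poset

  ◇-conjugate′ : ∀ {x y} → x ∧ ◇ y ≈ ⊥ → y ∧ ◇ x ≈ ⊥
  ◇-conjugate′ {x} {y} x∧◇y≈⊥ = trans (∧-comm y (◇ x)) (◇-conjugate x∧◇y≈⊥)

  -- Conjugation says that `◇ s ≤ ¬ x` iff `s ≤ ¬ ◇ x`. Thus `◇` is a lower adjoint and preserves
  -- existing joins; this is the disjointness form of that fact.
  ∧◇-supremum : ∀ {p} {J : Carrier → Set p} {s x} → IsSupremum B J s →
                (∀ {y} → J y → x ∧ ◇ y ≈ ⊥) → x ∧ ◇ s ≈ ⊥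
  ∧◇-supremum s-sup x∧◇J≈⊥ =
    ◇-conjugate′ (x≤¬y⇒x∧y≈⊥ (IsSupremum.least s-sup λ y∈J →
      x∧y≈⊥⇒x≤¬y (◇-conjugate′ (x∧◇J≈⊥ y∈J))))

  contact-isContact : ExcludedMiddle ℓ → IsContact B (ContactOf B ◇)
  contact-isContact em = record
    { C0 = λ {x} ⊥Cx → ⊥Cx (∧-zeroˡ (◇ x))
    -- From `x ≤ ◇ y` comes `x ≈ x ∧ ◇ y`, so a vanishing meet would force `x ≈ ⊥`.
    ; C1 = λ {x} {y} x≤y x≉⊥ x∧◇y≈⊥ → x≉⊥ (trans (≤-trans x≤y (x≤◇x y)) x∧◇y≈⊥)
    ; C2 = λ xCy y∧◇x≈⊥ → xCy (◇-conjugate′ y∧◇x≈⊥)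
    ; C3 = λ x≤y zCx z∧◇y≈⊥ → zCx (∧-disjoint-≤ (◇-mono x≤y) z∧◇y≈⊥)
    ; C4 = C4
    }
    where
    open ≈-Reasoning setoid

    C4 : ∀ {x y z} → ContactOf B ◇ x (y ∨ z) →
         ContactOf B ◇ x y ⊎ ContactOf B ◇ x z
    -- Contact is a negated equation, so picking a disjunct takes a classical case split.
    C4 {x} {y} {z} xC[y∨z] with em {P = x ∧ ◇ y ≈ ⊥}
    ... | no  xCy    = inj₁ xCy
    ... | yes x∧◇y≈⊥ = inj₂ λ x∧◇z≈⊥ → xC[y∨z] (begin
      x ∧ ◇ (y ∨ z)          ≈⟨ ∧-congˡ (◇-∨ y z) ⟩
      x ∧ (◇ y ∨ ◇ z)        ≈⟨ ∧-distribˡ-∨ x (◇ y) (◇ z) ⟩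
      (x ∧ ◇ y) ∨ (x ∧ ◇ z)  ≈⟨ ∨-cong x∧◇y≈⊥ x∧◇z≈⊥ ⟩
      ⊥ ∨ ⊥                  ≈⟨ ∨-identityˡ ⊥ ⟩
      ⊥                      ∎)

  contact-C4ᶜ : ∀ {p} → ExcludedMiddle (c ⊔ ℓ ⊔ p) → C4ᶜ B p (ContactOf B ◇)
  -- Double negation is eliminated twice: for the existential over `J`, and for each equation
  -- `x ∧ ◇ y ≈ ⊥`.
  contact-C4ᶜ {p} em x J sup xC⋁J = em⇒dne em λ ∄y →
    xC⋁J (∧◇-supremum sup λ {y} y∈J →
      em⇒dne (lowerExcludedMiddle (c ⊔ p) em) λ xCy → ∄y (y , y∈J , xCy))

  -- Being in contact with `x` means by definition having a nonzero meet with `◇ x`, so both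
  -- inclusions are identities.
  ◇-represents : ∀ x → Represents B (ContactOf B ◇) x (◇ x)
  ◇-represents x = id , id

lemma6p12 : {c ℓ p : Level} → ExcludedMiddle (c ⊔ ℓ ⊔ p) →
    (B : BooleanAlgebra c ℓ) → let open BooleanAlgebra B in
    IsComplete B p →
    (◇ : Op₁ Carrier) → IsKTB B ◇ →
    IsContact B (ContactOf B ◇) ×
    C4ᶜ B p (ContactOf B ◇) ×
    (∀ x → ∃! _≈_ (Represents B (ContactOf B ◇) x)) ×
    ((m : Op₁ Carrier) → (∀ x → Represents B (ContactOf B ◇) x (m x)) → ∀ x → ◇ x ≈ m x)
lemma6p12 {c} {ℓ} {p} em B _ ◇ isKTB =
  contact-isContact emℓ ,
  contact-C4ᶜ em ,
  (λ x → ◇ x , ◇-represents x , unique (◇-represents x)) ,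
  -- Only the representing property of `m` is given; uniqueness of representatives identifies `m x`
  -- with `◇ x`.
  (λ m m-represents x → unique (◇-represents x) (m-represents x))
  where
  open Order B
  open KTB B isKTB

  emℓ : ExcludedMiddle ℓ
  emℓ = lowerExcludedMiddle (c ⊔ p) em

  unique : ∀ {x y z} → Represents B (ContactOf B ◇) x y →
           Represents B (ContactOf B ◇) x z → BooleanAlgebra._≈_ B y z
  unique = represents-unique (em⇒dne emℓ) (ContactOf B ◇)
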